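{- Let $\varphi$ be a genHL formula in prenex normal form, let $T$ be a set of finite traces, let $\sigma$ be a generators interpretation (the "specification" interpretation), and let $\sigma'$ be a generators interpretation that is correct for the specification $\mathbf{H}(\varphi,\sigma)$ and the set $T$. Then for every trace assignment $\Pi$ defined on all trace variables in $\mathrm{Free}(\varphi)$: if $(\Pi,T,\sigma')\models\varphi$, then $(\Pi,T,\sigma)\models \mathit{passive}(\varphi,\sigma)$.
   Context: genHL syntax. Trace formulas: $\psi ::= \epsilon \mid c \mid p(\pi) \mid \psi[i:j] \mid \psi;\psi \mid \psi+\psi \mid \psi^* \mid \lfloor\psi\rfloor$, where $\pi$ is a trace variable, $c$ a constant, $p$ a projection function, $i,j$ integers. Formulas: $\varphi ::= \exists\pi\,\varphi \mid \exists \pi\in f(\pi_1,\dots,\pi_n)\,\varphi \mid \neg\varphi \mid \varphi\wedge\varphi \mid \psi\le\psi$, with $f$ a generator symbol of arity $n$; $\forall\pi\,\varphi := \neg\exists\pi\neg\varphi$ and $\forall\pi\in f(\dots)\varphi:=\neg\exists\pi\in f(\dots)\neg\varphi$. $\exists\pi$ is a passive quantifier, $\exists\pi\in f(\pi_1,\dots,\pi_n)$ an active one. Each variable is quantified at most once, and generator arguments $\pi_1,\dots,\pi_n$ of a quantifier are never bound inside the quantified subformula. $\mathrm{Free}(\varphi)$, $\mathrm{Bound}(\varphi)$ are the free/bound trace variables. Prenex normal form: all quantifiers precede a quantifier-free body. Semantics. A data domain provides an alphabet $\Sigma_{\mathcal D}$ and projection functions $p$ (applied letterwise to words). A trace assignment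 $\Pi$ maps trace variables to finite words. Trace formulas denote sets of words: $[\![c]\!]=\{c\}$, $[\![\epsilon]\!]=\{\epsilon\}$, $[\![p(\pi)]\!]=\{p(\Pi(\pi))\}$, slicing $[\![\psi[i:j]]\!]=\{\tau[i':j']\mid\tau\in[\![\psi]\!]\}$ where negative indices are counted from the end ($i'=|\tau|+i$ if $i<0$) and $\tau[i':j']=\epsilon$ unless $i'\le j'\le|\tau|-1$; $;$, $+$, ${}^*$ are concatenation, union, Kleene star of languages; $[\![\lfloor\psi\rfloor]\!]=\{a_1\cdots a_k\mid a_1^+\cdots a_k^+\in[\![\psi]\!], a_i\ne a_{i+1}\}$ (stutter reduction). A generators interpretation $\sigma$ assigns to each generator symbol $f$ of arity $n$ a function $f^\sigma:(\Sigma_{\mathcal D}^*)^n\to 2^{\Sigma_{\mathcal D}^*}$; "$f\in\sigma$" means $\sigma$ interprets $f$. For a set of finite traces $T$: $(\Pi,T,\sigma)\models\exists\pi\varphi$ iff some $\tau\in T$ has $(\Pi[\pi\mapsto\tau],T,\sigma)\models\varphi$; $(\Pi,T,\sigma)\models\exists\pi\in f(\pi_1,\dots,\pi_n)\varphi$ iff some $\tau\in f^\sigma(\Pi(\pi_1),\dots,\Pi(\pi_n))$ has $(\Pi[\pi\mapsto\tau],T,\sigma)\models\varphi$; $\neg,\wedge$ as usual; $(\Pi,T,\sigma)\models\psi_1\le\psi_2$ iff there exist $w_1\in[\![\psi_1]\!]_\Pi$, $w_2\in[\![\psi_2]\!]_\Pi$ with $w_1$ a prefix of $w_2$. $(T,\sigma)\models\varphi$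 iff some $\Pi$ gives $(\Pi,T,\sigma)\models\varphi$. $\mathbf{H}(\varphi,\sigma)=\{T;\{\$\}\mid (T,\sigma)\models\varphi\}$. Correct generators. Given a generators interpretation $\sigma$ containing $f$, a set $T$, a function $\mathit{spec}$ of arity $n$ and a formula $\varphi$ with $\pi_1,\dots,\pi_n\notin\mathrm{Bound}(\varphi)$: $f$ is correct for $\exists\pi\in f(\pi_1,\dots,\pi_n)\varphi$, $T$ and $\mathit{spec}$ iff for all $\Pi$ defined on $\pi_1,\dots,\pi_n$ and all $\tau_f\in f^\sigma(\Pi(\pi_1),\dots,\Pi(\pi_n))$ there is $\tau_s\in\mathit{spec}(\Pi(\pi_1),\dots,\Pi(\pi_n))$ such that $(\Pi[\pi\mapsto\tau_f],T,\sigma)\models\varphi$ implies $(\Pi[\pi\mapsto\tau_s],T,\sigma)\models\varphi$. $f$ is correct for $\forall\pi\in f(\pi_1,\dots,\pi_n)\varphi$, $T$ and $\mathit{spec}$ iff for all such $\Pi$ and all $\tau_s\in\mathit{spec}(\Pi(\pi_1),\dots,\Pi(\pi_n))$ there is $\tau_f\in f^\sigma(\Pi(\pi_1),\dots,\Pi(\pi_n))$ such that $(\Pi[\pi\mapsto\tau_s],T,\sigma)\models\varphi$ implies $(\Pi[\pi\mapsto\tau_f],T,\sigma)\models\varphi$. For $\varphi$ in prenex normal form, a generators interpretation $\sigma'$ is correct for $\mathbf{H}(\varphi,\sigma_{spec})$ and $T$ iff for every subformula $\mathbb{Q}\pi\in f(\pi_1,\dots,\pi_n)\varphi''$ ($\mathbb{Q}\in\{\forall,\exists\}$)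 of $\varphi$: if $f\notin\sigma_{spec}$ then $f$ (interpreted by $\sigma'$) is correct for that subformula, $T$, and the constant function $f_T$ always returning $T$; if $f\in\sigma_{spec}$ then $f$ (interpreted by $\sigma'$) is correct for that subformula, $T$, and $\mathit{spec}=f^{\sigma_{spec}}$. Passive version: $\mathit{passive}(\varphi,\sigma)$ is obtained from $\varphi$ by replacing every active quantifier $\mathbb{Q}\pi\in f(\pi_1,\dots,\pi_n)$ whose generator $f$ is not interpreted by $\sigma$ with the passive quantifier $\mathbb{Q}\pi$, leaving everything else unchanged.
   Formalization: In the definition of a generator correct for ∀π∈f(…)φ, the implication is taken for ¬φ instead of φ (a specified trace violating φ yields a generated trace violating φ); with φ itself the theorem fails, e.g. T={a,b}, f generating only a, φ = (π ≤ a). -}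

module Defs where

open import Data.Bool using (true; if_then_else_; _∧_)
open import Data.Empty using (⊥)
open import Data.Integer using (ℤ; +_; -[1+_]) renaming (_+_ to _+ℤ_)
open import Data.List using (List; []; _∷_; _++_; [_]; map; length; take; drop; replicate)
open import Data.List.Membership.Propositional using (_∈_; _∉_)
open import Data.List.Relation.Binary.Prefix.Heterogeneous using (Prefix)
open import Data.List.Relation.Unary.Linked using (Linked)
open import Data.List.Relation.Unary.Unique.Propositional using (Unique)
open import Data.Maybe using (Maybe; just; Is-just; is-just; fromMaybe)
open import Data.Nat using (ℕ; suc; _∸_; _≤ᵇ_; _<ᵇ_; _≟_)
open import Data.Product using (∃-syntax; _×_)
open import Data.Sum using (_⊎_)
open import Data.Unit using (⊤)
open import Data.Vec using (Vec; toList)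
open import Data.Vec.Relation.Binary.Pointwise.Inductive using (Pointwise)
open import Level using (0ℓ)
open import Relation.Binary.PropositionalEquality using (_≡_; _≢_)
open import Relation.Nullary using (¬_; does)
open import Relation.Unary using (Pred)

record DataDomain : Set₁ where
  field
    Letter  : Set
    Proj    : Set
    project : Proj → Letter → Letter

record GeneratorSymbols : Set₁ where
  field
    Gen   : Set
    arity : Gen → ℕ

TraceVar : Set
TraceVar = ℕ

module GenHL (D : DataDomain) (G : GeneratorSymbols) where
  open DataDomain D
  open GeneratorSymbols G

  Word : Set
  Word = List Letter

  Language : Set₁
  Language = Pred Word 0ℓ

  infixl 30 _⟦_⦂_⟧
  infixr 26 _⨾_
  infixr 25 _⊕_
  infix  24 _≼_
  infixr 22 _∧ᶠ_
  infix  23 ¬ᶠ_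

  data TraceFormula : Set where
    ε       : TraceFormula
    const   : Letter → TraceFormula
    proj    : Proj → TraceVar → TraceFormula
    _⟦_⦂_⟧  : TraceFormula → ℤ → ℤ → TraceFormula
    _⨾_     : TraceFormula → TraceFormula → TraceFormula
    _⊕_     : TraceFormula → TraceFormula → TraceFormula
    _⋆      : TraceFormula → TraceFormula
    ⌊_⌋     : TraceFormula → TraceFormula

  data Formula : Set where
    ∃ᵖ   : TraceVar → Formula → Formula
    ∃ᵃ   : TraceVar → (f : Gen) → Vec TraceVar (arity f) → Formula → Formula
    ¬ᶠ_  : Formula → Formula
    _∧ᶠ_ : Formula → Formula → Formula
    _≼_  : TraceFormula → TraceFormula → Formula

  ∀ᵖ : TraceVar → Formula → Formula
  ∀ᵖ π φ = ¬ᶠ ∃ᵖ π (¬ᶠ φ)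

  ∀ᵃ : TraceVar → (f : Gen) → Vec TraceVar (arity f) → Formula → Formula
  ∀ᵃ π f πs φ = ¬ᶠ ∃ᵃ π f πs (¬ᶠ φ)

  Occurs : TraceVar → TraceFormula → Set
  Occurs x ε             = ⊥
  Occurs x (const _)     = ⊥
  Occurs x (proj _ π)    = x ≡ π
  Occurs x (ψ ⟦ _ ⦂ _ ⟧) = Occurs x ψ
  Occurs x (ψ₁ ⨾ ψ₂)     = Occurs x ψ₁ ⊎ Occurs x ψ₂
  Occurs x (ψ₁ ⊕ ψ₂)     = Occurs x ψ₁ ⊎ Occurs x ψ₂
  Occurs x (ψ ⋆)         = Occurs x ψ
  Occurs x ⌊ ψ ⌋         = Occurs x ψ

  Free : Formula → Pred TraceVar 0ℓ
  Free (∃ᵖ π φ) x      = x ≢ π × Free φ x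
  Free (∃ᵃ π f πs φ) x = x ∈ toList πs ⊎ (x ≢ π × Free φ x)
  Free (¬ᶠ φ) x        = Free φ x
  Free (φ₁ ∧ᶠ φ₂) x    = Free φ₁ x ⊎ Free φ₂ x
  Free (ψ₁ ≼ ψ₂) x     = Occurs x ψ₁ ⊎ Occurs x ψ₂

  -- Listed with multiplicity, one entry per quantifier.
  bound : Formula → List TraceVar
  bound (∃ᵖ π φ)      = π ∷ bound φ
  bound (∃ᵃ π f πs φ) = π ∷ bound φ
  bound (¬ᶠ φ)        = bound φ
  bound (φ₁ ∧ᶠ φ₂)    = bound φ₁ ++ bound φ₂
  bound (ψ₁ ≼ ψ₂)     = []

  ArgumentsUnbound : Formula → Set
  ArgumentsUnbound (∃ᵖ π φ)      = ArgumentsUnbound φ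
  ArgumentsUnbound (∃ᵃ π f πs φ) = (∀ x → x ∈ toList πs → x ∉ bound φ) × ArgumentsUnbound φ
  ArgumentsUnbound (¬ᶠ φ)        = ArgumentsUnbound φ
  ArgumentsUnbound (φ₁ ∧ᶠ φ₂)    = ArgumentsUnbound φ₁ × ArgumentsUnbound φ₂
  ArgumentsUnbound (ψ₁ ≼ ψ₂)     = ⊤

  WellFormed : Formula → Set
  WellFormed φ = Unique (bound φ) × ArgumentsUnbound φ

  data QuantifierFree : Formula → Set where
    ¬ᶠ_  : ∀ {φ} → QuantifierFree φ → QuantifierFree (¬ᶠ φ)
    _∧ᶠ_ : ∀ {φ₁ φ₂} → QuantifierFree φ₁ → QuantifierFree φ₂ → QuantifierFree (φ₁ ∧ᶠ φ₂)
    atom : ∀ {ψ₁ ψ₂} → QuantifierFree (ψ₁ ≼ ψ₂)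

  data Prenex : Formula → Set where
    body : ∀ {φ} → QuantifierFree φ → Prenex φ
    exᵖ  : ∀ {π φ} → Prenex φ → Prenex (∃ᵖ π φ)
    allᵖ : ∀ {π φ} → Prenex φ → Prenex (∀ᵖ π φ)
    exᵃ  : ∀ {π f πs φ} → Prenex φ → Prenex (∃ᵃ π f πs φ)
    allᵃ : ∀ {π f πs φ} → Prenex φ → Prenex (∀ᵃ π f πs φ)

  -- Subformulas of a prenex formula that begin at a quantifier of its prefix
  -- (or at its body).  A universal quantifier is one unit here: the existential
  -- formula inside its expansion ¬∃¬ is not a subformula.
  data _⊑_ (χ : Formula) : Formula → Set where
    here    : χ ⊑ χ
    in-exᵖ  : ∀ {π φ} → χ ⊑ φ → χ ⊑ ∃ᵖ π φ
    in-allᵖ : ∀ {π φ} → χ ⊑ φ → χ ⊑ ∀ᵖ π φ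
    in-exᵃ  : ∀ {π f πs φ} → χ ⊑ φ → χ ⊑ ∃ᵃ π f πs φ
    in-allᵃ : ∀ {π f πs φ} → χ ⊑ φ → χ ⊑ ∀ᵃ π f πs φ

  Assignment : Set
  Assignment = TraceVar → Maybe Word

  DefinedOn : Assignment → Pred TraceVar 0ℓ → Set
  DefinedOn Π X = ∀ x → X x → Is-just (Π x)

  infix 30 _[_↦_]
  _[_↦_] : Assignment → TraceVar → Word → Assignment
  (Π [ π ↦ τ ]) x = if does (x ≟ π) then just τ else Π x

  Values : Assignment → ∀ {n} → Vec TraceVar n → Vec Word n → Set
  Values Π = Pointwise (λ π τ → Π π ≡ just τ)

  fromEnd : ℕ → ℤ → ℤ
  fromEnd n (+ i)    = + i
  fromEnd n -[1+ i ] = + n +ℤ -[1+ i ]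

  -- Positions count from 0 and both ends are included; an index that is still
  -- negative after counting from the end is out of range.
  slice : ℤ → ℤ → Word → Word
  slice i j τ = go (fromEnd (length τ) i) (fromEnd (length τ) j)
    where
    go : ℤ → ℤ → Word
    go (+ i′) (+ j′) =
      if (i′ ≤ᵇ j′) ∧ (j′ <ᵇ length τ) then take (suc (j′ ∸ i′)) (drop i′ τ) else []
    go _ _ = []

  data Star (L : Language) : Language where
    []  : Star L []
    _∷_ : ∀ {u v} → L u → Star L v → Star L (u ++ v)

  -- Stutters (a₁ ⋯ aₖ) is the language a₁⁺ ⋯ aₖ⁺.
  data Stutters : Word → Language where
    []  : Stutters [] []
    _∷_ : ∀ {a as v} (n : ℕ) → Stutters as v → Stutters (a ∷ as) (replicate (suc n) a ++ v)

  -- A projection of an undefined variable denotes the empty language.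
  ⟦_⟧ : TraceFormula → Assignment → Language
  ⟦ ε ⟧ Π w             = w ≡ []
  ⟦ const c ⟧ Π w       = w ≡ [ c ]
  ⟦ proj p π ⟧ Π w      = ∃[ τ ] Π π ≡ just τ × w ≡ map (project p) τ
  ⟦ ψ ⟦ i ⦂ j ⟧ ⟧ Π w   = ∃[ τ ] ⟦ ψ ⟧ Π τ × w ≡ slice i j τ
  ⟦ ψ₁ ⨾ ψ₂ ⟧ Π w       = ∃[ u ] ∃[ v ] ⟦ ψ₁ ⟧ Π u × ⟦ ψ₂ ⟧ Π v × w ≡ u ++ v
  ⟦ ψ₁ ⊕ ψ₂ ⟧ Π w       = ⟦ ψ₁ ⟧ Π w ⊎ ⟦ ψ₂ ⟧ Π w
  ⟦ ψ ⋆ ⟧ Π w           = Star (⟦ ψ ⟧ Π) w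
  ⟦ ⌊ ψ ⌋ ⟧ Π w         = Linked _≢_ w × (∃[ v ] Stutters w v × ⟦ ψ ⟧ Π v)

  -- nothing: the symbol is not interpreted.
  Interpretation : Set₁
  Interpretation = (f : Gen) → Maybe (Vec Word (arity f) → Language)

  Interprets : Interpretation → Gen → Set
  Interprets σ f = is-just (σ f) ≡ true

  -- The traces generated by f; none if f is not interpreted.
  Generates : Interpretation → (f : Gen) → Vec Word (arity f) → Language
  Generates σ f = fromMaybe (λ _ _ → ⊥) (σ f)

  infix 15 ⟨_,_,_⟩⊨_
  ⟨_,_,_⟩⊨_ : Assignment → Language → Interpretation → Formula → Set
  ⟨ Π , T , σ ⟩⊨ ∃ᵖ π φ      = ∃[ τ ] T τ × (⟨ Π [ π ↦ τ ] , T , σ ⟩⊨ φ)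
  ⟨ Π , T , σ ⟩⊨ ∃ᵃ π f πs φ =
    ∃[ ws ] Values Π πs ws × (∃[ τ ] Generates σ f ws τ × (⟨ Π [ π ↦ τ ] , T , σ ⟩⊨ φ))
  ⟨ Π , T , σ ⟩⊨ ¬ᶠ φ        = ¬ (⟨ Π , T , σ ⟩⊨ φ)
  ⟨ Π , T , σ ⟩⊨ φ₁ ∧ᶠ φ₂    = (⟨ Π , T , σ ⟩⊨ φ₁) × (⟨ Π , T , σ ⟩⊨ φ₂)
  ⟨ Π , T , σ ⟩⊨ ψ₁ ≼ ψ₂     = ∃[ w₁ ] ∃[ w₂ ] ⟦ ψ₁ ⟧ Π w₁ × ⟦ ψ₂ ⟧ Π w₂ × Prefix _≡_ w₁ w₂

  -- In both correctness notions Π ranges over the assignments defined on the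
  -- generator's arguments (with values ws) and on the other free variables of
  -- the quantified formula, so that satisfaction of φ is meaningful.

  Correct∃ : Interpretation → Language → (π : TraceVar) (f : Gen) → Vec TraceVar (arity f) →
             Formula → (spec : Vec Word (arity f) → Language) → Set
  Correct∃ σ T π f πs φ spec =
    Interprets σ f ×
    (∀ Π ws → Values Π πs ws → DefinedOn Π (Free (∃ᵃ π f πs φ)) →
     ∀ τf → Generates σ f ws τf →
     ∃[ τs ] spec ws τs ×
       (⟨ Π [ π ↦ τf ] , T , σ ⟩⊨ φ → ⟨ Π [ π ↦ τs ] , T , σ ⟩⊨ φ))

  -- The implication is about the matrix ¬φ of ∀π∈f.φ = ¬∃π∈f.¬φ: a specified
  -- trace violating φ must be matched by a generated trace violating φ.  With φ
  -- in place of ¬φ, soundness fails: for T = {a, b}, f generating only a, and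
  -- φ = (π ≤ a), the generated trace satisfies φ, so the implication always
  -- holds, and ∀π∈f.φ is true while ∀π.φ is false.
  Correct∀ : Interpretation → Language → (π : TraceVar) (f : Gen) → Vec TraceVar (arity f) →
             Formula → (spec : Vec Word (arity f) → Language) → Set
  Correct∀ σ T π f πs φ spec =
    Interprets σ f ×
    (∀ Π ws → Values Π πs ws → DefinedOn Π (Free (∀ᵃ π f πs φ)) →
     ∀ τs → spec ws τs →
     ∃[ τf ] Generates σ f ws τf ×
       (⟨ Π [ π ↦ τs ] , T , σ ⟩⊨ ¬ᶠ φ → ⟨ Π [ π ↦ τf ] , T , σ ⟩⊨ ¬ᶠ φ))

  specFor : Interpretation → Language → (f : Gen) → Vec Word (arity f) → Language
  specFor σ T f = fromMaybe (λ _ → T) (σ f)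

  -- σ′ is correct for the specification given by φ and σ, and the set T.
  Correct : (σ′ : Interpretation) (φ : Formula) (σ : Interpretation) (T : Language) → Set
  Correct σ′ φ σ T =
    (∀ π f πs φ″ → ∃ᵃ π f πs φ″ ⊑ φ → Correct∃ σ′ T π f πs φ″ (specFor σ T f)) ×
    (∀ π f πs φ″ → ∀ᵃ π f πs φ″ ⊑ φ → Correct∀ σ′ T π f πs φ″ (specFor σ T f))

  passive : Formula → Interpretation → Formula
  passive (∃ᵖ π φ) σ      = ∃ᵖ π (passive φ σ)
  passive (∃ᵃ π f πs φ) σ =
    if is-just (σ f) then ∃ᵃ π f πs (passive φ σ) else ∃ᵖ π (passive φ σ)
  passive (¬ᶠ φ) σ        = ¬ᶠ passive φ σ
  passive (φ₁ ∧ᶠ φ₂) σ    = passive φ₁ σ ∧ᶠ passive φ₂ σ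
  passive (ψ₁ ≼ ψ₂) σ     = ψ₁ ≼ ψ₂

{-# OPTIONS --safe #-}
-- Induction on the quantifier prefix.  At an existential quantifier correctness
-- turns a generated witness into a specified one.  At a universal one it turns a
-- specified counterexample into a generated one; the induction hypothesis is then
-- used in contrapositive form, so no classical reasoning is needed.  The body has
-- no quantifiers, so its meaning does not depend on the interpretation.
module Submission where

open import Defs
open import Data.Bool using (true; false) renaming (T to Bool-T)
open import Data.List.Membership.Propositional using (_∈_)
open import Data.List.Relation.Unary.Any using (here; there)
open import Data.Maybe using (Maybe; just; nothing; Is-just; is-just; fromMaybe)
open import Data.Maybe.Relation.Unary.Any using (just)
open import Data.Nat using (_≡ᵇ_)
open import Data.Nat.Properties using (≡⇒≡ᵇ)
open import Data.Product using (∃-syntax; _×_; _,_; proj₁; proj₂)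
open import Data.Sum using (inj₁; inj₂)
open import Data.Unit using (tt)
open import Data.Vec using (Vec; []; _∷_; toList)
open import Data.Vec.Relation.Binary.Pointwise.Inductive using ([]; _∷_)
open import Function using (_∘_; _⇔_; mk⇔; Equivalence)
open import Relation.Binary.PropositionalEquality using (_≡_; refl; sym; subst; _≢_)
open import Relation.Unary using (Pred)

Is-just⇒≡just : ∀ {a} {A : Set a} {m : Maybe A} → Is-just m → ∃[ x ] m ≡ just x
Is-just⇒≡just {m = just x} _ = x , refl

-- Reconciles `specFor` with `Generates`: on an uninterpreted symbol they default to `T` and to the
-- empty language respectively, but on an interpreted one the default is never reached.
fromMaybe-just : ∀ {a} {A : Set a} (d e : A) (m : Maybe A) →
                 is-just m ≡ true → fromMaybe d m ≡ fromMaybe e m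
fromMaybe-just d e (just x) _ = refl

fromMaybe-nothing : ∀ {a} {A : Set a} (d : A) (m : Maybe A) →
                    is-just m ≡ false → fromMaybe d m ≡ d
fromMaybe-nothing d nothing _ = refl

module _ {D : DataDomain} {G : GeneratorSymbols} where
  open GenHL D G

  DefinedOn-update : ∀ {Π π τ} {X : Pred TraceVar _} →
                     DefinedOn Π (λ x → x ≢ π × X x) → DefinedOn (Π [ π ↦ τ ]) X
  -- `does (x ≟ π)` computes to `x ≡ᵇ π`, so this match also reduces the updated assignment.
  DefinedOn-update {π = π} def x Xx with x ≡ᵇ π in eq
  ... | true  = just tt
  ... | false = def x ((λ x≡π → subst Bool-T eq (≡⇒≡ᵇ x π x≡π)) , Xx)

  values : ∀ {Π n} (πs : Vec TraceVar n) →
           DefinedOn Π (_∈ toList πs) → ∃[ ws ] Values Π πs ws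
  values []       def = [] , []
  values (π ∷ πs) def =
    let w  , eq  = Is-just⇒≡just (def π (here refl))
        ws , eqs = values πs (λ x → def x ∘ there)
    in  w ∷ ws , eq ∷ eqs

  module _ {T : Language} {σ : Interpretation} where

    -- `specFor` and `passive` branch on the same test, so a specified trace is a witness whichever
    -- quantifier `passive` leaves.
    ⊨-passive-∃ᵃ : ∀ {Π π} f {πs ws τ} φ → Values Π πs ws → specFor σ T f ws τ →
                   ⟨ Π [ π ↦ τ ] , T , σ ⟩⊨ passive φ σ →
                   ⟨ Π , T , σ ⟩⊨ passive (∃ᵃ π f πs φ) σ
    ⊨-passive-∃ᵃ f {ws = ws} {τ} φ vals s sat with is-just (σ f) in eq
    ... | true  = ws , vals , τ ,
      subst (λ g → g ws τ) (fromMaybe-just _ _ (σ f) eq) s , sat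
    ... | false = τ , subst (λ g → g ws τ) (fromMaybe-nothing _ (σ f) eq) s , sat

    -- A passive quantifier records no argument values; definedness on `πs` recovers them.
    ⊨-passive-∃ᵃ⁻¹ : ∀ {Π π} f {πs} φ → DefinedOn Π (_∈ toList πs) →
                     ⟨ Π , T , σ ⟩⊨ passive (∃ᵃ π f πs φ) σ →
                     ∃[ ws ] Values Π πs ws × (∃[ τ ] specFor σ T f ws τ ×
                       (⟨ Π [ π ↦ τ ] , T , σ ⟩⊨ passive φ σ))
    ⊨-passive-∃ᵃ⁻¹ f {πs} φ def sat with is-just (σ f) in eq
    ⊨-passive-∃ᵃ⁻¹ f {πs} φ def (ws , vals , τ , g , sat) | true =
      ws , vals , τ , subst (λ h → h ws τ) (fromMaybe-just _ _ (σ f) eq) g , sat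
    ⊨-passive-∃ᵃ⁻¹ f {πs} φ def (τ , t , sat) | false =
      let ws , vals = values πs def
      in  ws , vals , τ , subst (λ h → h ws τ) (sym (fromMaybe-nothing _ (σ f) eq)) t , sat

    module _ {σ′ : Interpretation} where

      -- An equivalence rather than an implication, because negation swaps the two directions.
      quantifierFree-⊨ : ∀ {Π φ} → QuantifierFree φ →
                         (⟨ Π , T , σ′ ⟩⊨ φ) ⇔ (⟨ Π , T , σ ⟩⊨ passive φ σ)
      quantifierFree-⊨ (¬ᶠ q) =
        let open Equivalence (quantifierFree-⊨ q) in mk⇔ (_∘ from) (_∘ to)
      quantifierFree-⊨ (q₁ ∧ᶠ q₂) =
        let module E₁ = Equivalence (quantifierFree-⊨ q₁)
            module E₂ = Equivalence (quantifierFree-⊨ q₂)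
        in  mk⇔ (λ (s₁ , s₂) → E₁.to s₁ , E₂.to s₂)
                (λ (s₁ , s₂) → E₁.from s₁ , E₂.from s₂)
      quantifierFree-⊨ atom = mk⇔ (λ s → s) (λ s → s)

      Correct-⊑ : ∀ {φ χ} → (∀ {ξ} → ξ ⊑ χ → ξ ⊑ φ) → Correct σ′ φ σ T → Correct σ′ χ σ T
      Correct-⊑ inc (c∃ , c∀) =
        (λ π f πs ξ → c∃ π f πs ξ ∘ inc) , (λ π f πs ξ → c∀ π f πs ξ ∘ inc)

      passive-sound : ∀ {φ} → Prenex φ → Correct σ′ φ σ T →
                      ∀ {Π} → DefinedOn Π (Free φ) →
                      ⟨ Π , T , σ′ ⟩⊨ φ → ⟨ Π , T , σ ⟩⊨ passive φ σ
      passive-sound (body q) c def sat = Equivalence.to (quantifierFree-⊨ q) sat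
      passive-sound (exᵖ p) c def (τ , t , sat) =
        τ , t , passive-sound p (Correct-⊑ in-exᵖ c) (DefinedOn-update def) sat
      passive-sound (allᵖ p) c def sat (τ , t , unsat) =
        sat (τ , t , unsat ∘ passive-sound p (Correct-⊑ in-allᵖ c) (DefinedOn-update def))
      passive-sound (exᵃ {π} {f} {πs} {φ} p) c def (ws , vals , τf , g , sat) =
        -- `transfer` replaces `τf` by `τs` while still under `σ′`; only then does the induction
        -- hypothesis pass to `σ`.
        let τs , s , transfer = proj₂ (proj₁ c π f πs φ here) _ ws vals def τf g
        in  ⊨-passive-∃ᵃ f φ vals s
              (passive-sound p (Correct-⊑ in-exᵃ c)
                (DefinedOn-update (λ x → def x ∘ inj₂)) (transfer sat))
      passive-sound (allᵃ {π} {f} {πs} {φ} p) c def sat cex =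
        -- `cex` satisfies the existential under the outer negation of the expanded universal, hence
        -- the matrix `¬ᶠ φ`.
        let ws , vals , τs , s , unsat = ⊨-passive-∃ᵃ⁻¹ f (¬ᶠ φ) (λ x → def x ∘ inj₁) cex
            τf , g , transfer = proj₂ (proj₂ c π f πs φ here) _ ws vals def τs s
        -- The contraposed induction hypothesis refutes `φ` at `τs` under `σ′`; `transfer` moves
        -- this refutation to the generated `τf`, contradicting `sat`.
        in  sat (ws , vals , τf , g , transfer
              (unsat ∘ passive-sound p (Correct-⊑ in-allᵃ c)
                (DefinedOn-update (λ x → def x ∘ inj₂))))

theorem1 : (D : DataDomain) (G : GeneratorSymbols) →
    let open GenHL D G in
    (φ : Formula) → WellFormed φ → Prenex φ →
    (T : Language) (σ σ′ : Interpretation) → Correct σ′ φ σ T →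
    (Π : Assignment) → DefinedOn Π (Free φ) →
    ⟨ Π , T , σ′ ⟩⊨ φ → ⟨ Π , T , σ ⟩⊨ passive φ σ
theorem1 D G φ _ p T σ σ′ c Π def = passive-sound p c def
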